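{- Let $\Sigma$ be a signature of contractive operators, let $\mathcal{O}_\Sigma$ be its quantitative theory and $\tilde\Sigma$ the associated endofunctor on $\mathbf{Met}$. The monads $T_{\mathcal{O}_\Sigma}$ and $\tilde\Sigma^*$ (the free monad on $\tilde\Sigma$) on $\mathbf{Met}$ are isomorphic.
   Context: An extended metric space is a set $X$ with $d_X:X\times X\to[0,\infty]$ satisfying $d_X(x,y)=0$ iff $x=y$, symmetry and the triangle inequality. $\mathbf{Met}$ is the category of extended metric spaces and non-expansive maps. Quantitative theories. A signature $\Sigma$ is a set of function symbols $f:n$ of finite arity $n\in\mathbb{N}$. Fix a countably infinite set of variables $V$; terms are $\Sigma$-terms over $V$. A quantitative equation is an expression $t=_\varepsilon s$ with $t,s$ terms and $\varepsilon\in\mathbb{Q}_{\ge0}$. A conditional quantitative equation is $\Gamma\vdash t=_\varepsilon s$ with $\Gamma$ a finite set of quantitative equations. A quantitative equational theory of type $\Sigma$ is a set $\mathcal{U}$ of conditional quantitative equations containing (for all variables and rationals $\varepsilon,\varepsilon'\ge 0$) $\vdash x=_0x$; $\{x=_\varepsilon y\}\vdash y=_\varepsilon x$; $\{x=_\varepsilon z,z=_{\varepsilon'}y\}\vdash x=_{\varepsilon+\varepsilon'}y$; $\{x=_\varepsilon y\}\vdash x=_{\varepsilon+\varepsilon'}y$ for $\varepsilon'>0$; $\{x_i=_\varepsilon y_i\mid i=1,\dots,n\}\vdash f(x_1,\dots,x_n)=_\varepsilon f(y_1,\dots,y_n)$ for $f:n\in\Sigma$; and closed under: continuity (if $\Gamma\vdash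 t=_{\varepsilon'}s\in\mathcal{U}$ for all $\varepsilon'>\varepsilon$ then $\Gamma\vdash t=_\varepsilon s\in\mathcal{U}$), substitution of terms for variables, assumption ($\Gamma\vdash\phi\in\mathcal{U}$ whenever $\phi\in\Gamma$), and cut (if $\Gamma\vdash\phi\in\mathcal{U}$ for all $\phi\in\Theta$ and $\Theta\vdash\psi\in\mathcal{U}$ then $\Gamma\vdash\psi\in\mathcal{U}$). A set $A$ of conditional quantitative equations axiomatizes $\mathcal{U}$ if $\mathcal{U}$ is the smallest theory containing $A$. Models. A quantitative $\Sigma$-algebra is an extended metric space $A$ with, for each $f:n\in\Sigma$, a map $f^A:A^n\to A$ that is non-expansive for the max metric on $A^n$. It satisfies $\Gamma\vdash t=_\varepsilon s$ if for every assignment $\iota:V\to A$ (extended homomorphically to terms), $d_A(\iota(t'),\iota(s'))\le\varepsilon'$ for all $t'=_{\varepsilon'}s'\in\Gamma$ implies $d_A(\iota(t),\iota(s))\le\varepsilon$. $\mathbb{K}(\Sigma,\mathcal{U})$ is the category of quantitative $\Sigma$-algebras satisfying all members of $\mathcal{U}$, with non-expansive $\Sigma$-homomorphisms. The forgetful functor $\mathbb{K}(\Sigma,\mathcal{U})\to\mathbf{Met}$ has a left adjoint (known result); $T_{\mathcal{U}}$ denotes the induced monad on $\mathbf{Met}$. Contractive operators. A signature of contractive operators $\Sigma$ is an at most countable collection of function symbols $f$, each with an arity $n\in\mathbb{N}$ and a contractive factor $0<c<1$, written $f:\langle n,c\rangle\in\Sigma$. $\mathcal{O}_\Sigma$ is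 axiomatized by, for each $f:\langle n,c\rangle\in\Sigma$: $\{x_1=_\varepsilon y_1,\dots,x_n=_\varepsilon y_n\}\vdash f(x_1,\dots,x_n)=_\delta f(y_1,\dots,y_n)$ for all $\varepsilon,\delta\in\mathbb{Q}_{\ge0}$ with $\delta\ge c\varepsilon$. The endofunctor is $\tilde\Sigma X=\coprod_{f:\langle n,c\rangle\in\Sigma}c\cdot X^n$, where $X^n$ carries the max metric, $c\cdot(Y,d_Y)=(Y,c\,d_Y)$ (with $c\cdot\infty=\infty$), and coproducts are disjoint unions with distance $\infty$ between components. Free monad on an endofunctor $H$: a monad $H^*$ with a natural transformation $\gamma:H\Rightarrow H^*$ that is initial among pairs $(S,\lambda:H\Rightarrow S)$ with $S$ a monad (morphisms: monad maps commuting with the transformations). It exists for $\tilde\Sigma$ on $\mathbf{Met}$. -}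

module Defs where

open import Level using (Level; 0ℓ; _⊔_) renaming (suc to lsuc)
open import Data.Empty using (⊥; ⊥-elim)
open import Data.Fin.Base using (Fin)
open import Data.List.Base using (List; []; _∷_; map; tabulate)
open import Data.List.Membership.Propositional using (_∈_)
open import Data.Nat.Base using (ℕ)
import Data.Nat.Properties as ℕₚ
open import Data.Product using (Σ; Σ-syntax; ∃; ∃-syntax; _×_; _,_; proj₁; proj₂)
open import Data.Rational.Base as ℚ using (ℚ; 0ℚ; 1ℚ; ½)
import Data.Rational.Properties as ℚₚ
open import Data.Sum.Base using (inj₁; inj₂)
open import Data.Vec.Functional using (Vector)
open import Function.Base using (_∘_)
open import Function.Bundles using (_↣_)
open import Function.Metric.Structures using (IsGeneralMetric)
open import Relation.Binary.Definitions using (DecidableEquality)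
open import Relation.Binary.PropositionalEquality
  using (_≡_; refl; sym; trans; cong; subst)
open import Relation.Binary.Structures using (IsEquivalence; IsPartialOrder)
open import Relation.Nullary using (Dec; yes; no; contradiction)
open import Relation.Nullary.Decidable using (via-injection)
open import Relation.Unary using (Pred; _⊆_)

infix 3 _,₊_

record ℚ≥0 : Set where
  constructor _,₊_
  field
    value  : ℚ
    0≤value : 0ℚ ℚ.≤ value

open ℚ≥0 public

infix 4 _≤₊_ _<₊_
infixl 6 _+₊_
infixl 7 _*₊_

_≤₊_ _<₊_ : ℚ≥0 → ℚ≥0 → Set
p ≤₊ q = value p ℚ.≤ value q
p <₊ q = value p ℚ.< value q

0₊ 1₊ : ℚ≥0
0₊ = 0ℚ ,₊ ℚₚ.≤-refl
1₊ = 1ℚ ,₊ ℚₚ.nonNegative⁻¹ 1ℚ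

_+₊_ _*₊_ : ℚ≥0 → ℚ≥0 → ℚ≥0
p +₊ q = value p ℚ.+ value q ,₊ ℚₚ.+-mono-≤ (0≤value p) (0≤value q)
p *₊ q = value p ℚ.* value q ,₊
  ℚₚ.nonNegative⁻¹ _ ⦃ ℚₚ.nonNeg*nonNeg⇒nonNeg
    (value p) ⦃ ℚ.nonNegative (0≤value p) ⦄ (value q) ⦃ ℚ.nonNegative (0≤value q) ⦄ ⦄

private
  dense₊ : ∀ {p q} → p <₊ q → ∃[ m ] p <₊ m × m <₊ q
  dense₊ {p} p<q with ℚₚ.<-dense p<q
  ... | m , p<m , m<q =
    (m ,₊ ℚₚ.≤-trans (0≤value p) (ℚₚ.<⇒≤ p<m)) , p<m , m<q

  above₊ : ∀ q → ∃[ q′ ] q <₊ q′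
  above₊ q = q +₊ 1₊ ,
    subst (ℚ._< value q ℚ.+ 1ℚ) (ℚₚ.+-identityʳ (value q))
      (ℚₚ.+-monoʳ-< (value q) (ℚₚ.positive⁻¹ 1ℚ))

-- A point r of [0,∞] is presented by the set of rationals q ≥ 0 with
-- r ≤ q; hence the order is reverse inclusion.  Exactly the upward closed
-- sets that contain their infimum, if it is rational, arise in this way;
-- the empty set presents ∞.

record [0,∞] : Set₁ where
  field
    Upper  : ℚ≥0 → Set
    upward : ∀ {p q} → p ≤₊ q → Upper p → Upper q
    closed : ∀ {p} → (∀ q → p <₊ q → Upper q) → Upper p

open [0,∞] public

infix 4 _≤∞_ _<∞_ _≃∞_
infixl 6 _+∞_
infixl 7 _*∞_

_≤∞_ _≃∞_ : [0,∞] → [0,∞] → Set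
a ≤∞ b = ∀ q → Upper b q → Upper a q
a ≃∞ b = a ≤∞ b × b ≤∞ a

fromℚ : ℚ≥0 → [0,∞]
fromℚ p = record
  { Upper  = p ≤₊_
  ; upward = λ q≤r p≤q → ℚₚ.≤-trans p≤q q≤r
  ; closed = λ {q} h → ℚₚ.≮⇒≥ λ q<p →
      let m , q<m , m<p = dense₊ {q} {p} q<p
      in ℚₚ.<-irrefl refl (ℚₚ.<-≤-trans m<p (h m q<m))
  }

_<∞_ : [0,∞] → [0,∞] → Set
a <∞ b = ∃[ p ] ∃[ q ] a ≤∞ fromℚ p × p <₊ q × fromℚ q ≤∞ b

inf : {I : Set} → (I → ℚ≥0) → [0,∞]
inf f = record
  { Upper  = λ q → ∀ q′ → q <₊ q′ → ∃[ i ] f i ≤₊ q′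
  ; upward = λ p≤q h q′ q<q′ → h q′ (ℚₚ.≤-<-trans p≤q q<q′)
  ; closed = λ {p} h q′ p<q′ →
      let m , p<m , m<q′ = dense₊ {p} {q′} p<q′ in h m p<m q′ m<q′
  }

-- The maximum of the empty family is 0, so X ^ₘ 0 is a single point at
-- distance 0 from itself.

max : ∀ {n} → (Fin n → [0,∞]) → [0,∞]
max a = record
  { Upper  = λ q → ∀ i → Upper (a i) q
  ; upward = λ p≤q h i → upward (a i) p≤q (h i)
  ; closed = λ h i → closed (a i) λ q p<q → h q p<q i
  }

0∞ 1∞ ∞ : [0,∞]
0∞ = fromℚ 0₊
1∞ = fromℚ 1₊
∞  = inf {⊥} λ ()

-- If either argument is ∞, the infimum is over the empty set; hence
-- a +∞ ∞ and a *∞ ∞ are ∞.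

_+∞_ _*∞_ : [0,∞] → [0,∞] → [0,∞]
a +∞ b = inf {∃ (Upper a) × ∃ (Upper b)} λ where ((r , _) , (s , _)) → r +₊ s
a *∞ b = inf {∃ (Upper a) × ∃ (Upper b)} λ where ((r , _) , (s , _)) → r *₊ s

≤∞-refl : ∀ {a} → a ≤∞ a
≤∞-refl q h = h

≤∞-trans : ∀ {a b c} → a ≤∞ b → b ≤∞ c → a ≤∞ c
≤∞-trans a≤b b≤c q h = a≤b q (b≤c q h)

≤∞-isPartialOrder : IsPartialOrder _≃∞_ _≤∞_
≤∞-isPartialOrder = record
  { isPreorder = record
    { isEquivalence = record
      { refl  = λ {a} → ≤∞-refl {a} , ≤∞-refl {a}
      ; sym   = λ (p , q) → q , p
      ; trans = λ {a} {b} {c} (p , q) (r , s) →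
          ≤∞-trans {a} {b} {c} p r , ≤∞-trans {c} {b} {a} s q
      }
    ; reflexive = proj₁
    ; trans     = λ {a} {b} {c} → ≤∞-trans {a} {b} {c}
    }
  ; antisym = _,_
  }

0≤∞ : ∀ {a} → 0∞ ≤∞ a
0≤∞ q _ = 0≤value q

≤0⇒Upper : ∀ {a} → a ≤∞ 0∞ → ∀ q → Upper a q
≤0⇒Upper a≤0 q = a≤0 q (0≤value q)

private
  +∞-mono : ∀ {a b a′ b′} → a ≤∞ a′ → b ≤∞ b′ → a +∞ b ≤∞ a′ +∞ b′
  +∞-mono a≤ b≤ q h q′ q<q′ with h q′ q<q′
  ... | ((r , ur) , (s , us)) , le = ((r , a≤ r ur) , (s , b≤ s us)) , le

  ∞-absurd : ∀ {ℓ} {A : Set ℓ} q → Upper ∞ q → A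
  ∞-absurd q h with above₊ q
  ... | q′ , q<q′ = ⊥-elim (proj₁ (h q′ q<q′))

  ∞+-absurd : ∀ {ℓ} {A : Set ℓ} {b} q → Upper (∞ +∞ b) q → A
  ∞+-absurd q h with above₊ q
  ... | q′ , q<q′ with h q′ q<q′
  ... | ((r , ur) , _) , _ = ∞-absurd r ur

  +∞-absurd : ∀ {ℓ} {A : Set ℓ} {a} q → Upper (a +∞ ∞) q → A
  +∞-absurd q h with above₊ q
  ... | q′ , q<q′ with h q′ q<q′
  ... | (_ , (s , us)) , _ = ∞-absurd s us

  *∞-monoʳ : ∀ c {a b} → a ≤∞ b → c *∞ a ≤∞ c *∞ b
  *∞-monoʳ c a≤b q h q′ q<q′ with h q′ q<q′
  ... | ((r , ur) , (s , us)) , le = ((r , ur) , (s , a≤b s us)) , le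

  *₊-mono : ∀ {p q r s} → p ≤₊ q → r ≤₊ s → p *₊ r ≤₊ q *₊ s
  *₊-mono {p} {q} {r} {s} p≤q r≤s = ℚₚ.≤-trans
    (ℚₚ.*-monoʳ-≤-nonNeg (value r) ⦃ ℚ.nonNegative (0≤value r) ⦄ p≤q)
    (ℚₚ.*-monoˡ-≤-nonNeg (value q) ⦃ ℚ.nonNegative (0≤value q) ⦄ r≤s)

record Category (o ℓ e : Level) : Set (lsuc (o ⊔ ℓ ⊔ e)) where
  infix  4 _⇒_ _≈_
  infixr 9 _∘ᶜ_
  field
    Obj  : Set o
    _⇒_  : Obj → Obj → Set ℓ
    _≈_  : ∀ {A B} → A ⇒ B → A ⇒ B → Set e
    idᶜ  : ∀ {A} → A ⇒ A
    _∘ᶜ_ : ∀ {A B C} → B ⇒ C → A ⇒ B → A ⇒ C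

    equiv     : ∀ {A B} → IsEquivalence (_≈_ {A} {B})
    ∘-resp-≈  : ∀ {A B C} {f h : B ⇒ C} {g i : A ⇒ B} →
                f ≈ h → g ≈ i → f ∘ᶜ g ≈ h ∘ᶜ i
    assoc     : ∀ {A B C D} {f : A ⇒ B} {g : B ⇒ C} {h : C ⇒ D} →
                (h ∘ᶜ g) ∘ᶜ f ≈ h ∘ᶜ (g ∘ᶜ f)
    identityˡ : ∀ {A B} {f : A ⇒ B} → idᶜ ∘ᶜ f ≈ f
    identityʳ : ∀ {A B} {f : A ⇒ B} → f ∘ᶜ idᶜ ≈ f

  module Equiv {A B : Obj} = IsEquivalence (equiv {A} {B})

private
  variable
    o ℓ e o′ ℓ′ e′ o″ ℓ″ e″ : Level

record Functor (C : Category o ℓ e) (D : Category o′ ℓ′ e′)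
    : Set (o ⊔ ℓ ⊔ e ⊔ o′ ⊔ ℓ′ ⊔ e′) where
  private
    module C = Category C
    module D = Category D
  field
    F₀ : C.Obj → D.Obj
    F₁ : ∀ {A B} → A C.⇒ B → F₀ A D.⇒ F₀ B

    F-resp-≈     : ∀ {A B} {f g : A C.⇒ B} → f C.≈ g → F₁ f D.≈ F₁ g
    identity     : ∀ {A} → F₁ (C.idᶜ {A}) D.≈ D.idᶜ
    homomorphism : ∀ {X Y Z} {f : X C.⇒ Y} {g : Y C.⇒ Z} →
                   F₁ (g C.∘ᶜ f) D.≈ F₁ g D.∘ᶜ F₁ f

Idᶠ : {C : Category o ℓ e} → Functor C C
Idᶠ {C = C} = record
  { F₀ = λ A → A
  ; F₁ = λ f → f
  ; F-resp-≈ = λ f≈g → f≈g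
  ; identity = Category.Equiv.refl C
  ; homomorphism = Category.Equiv.refl C
  }

infixr 9 _∘ᶠ_

_∘ᶠ_ : {C : Category o ℓ e} {D : Category o′ ℓ′ e′} {E : Category o″ ℓ″ e″} →
       Functor D E → Functor C D → Functor C E
_∘ᶠ_ {E = E} G F = record
  { F₀ = λ A → G.F₀ (F.F₀ A)
  ; F₁ = λ f → G.F₁ (F.F₁ f)
  ; F-resp-≈ = λ f≈g → G.F-resp-≈ (F.F-resp-≈ f≈g)
  ; identity = Category.Equiv.trans E (G.F-resp-≈ F.identity) G.identity
  ; homomorphism =
      Category.Equiv.trans E (G.F-resp-≈ F.homomorphism) G.homomorphism
  }
  where
    module F = Functor F
    module G = Functor G

record NaturalTransformation {C : Category o ℓ e} {D : Category o′ ℓ′ e′}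
    (F G : Functor C D) : Set (o ⊔ ℓ ⊔ e ⊔ o′ ⊔ ℓ′ ⊔ e′) where
  private
    module C = Category C
    module D = Category D
    module F = Functor F
    module G = Functor G
  field
    component : ∀ A → F.F₀ A D.⇒ G.F₀ A
    natural   : ∀ {A B} (f : A C.⇒ B) →
                component B D.∘ᶜ F.F₁ f D.≈ G.F₁ f D.∘ᶜ component A

record Monad (C : Category o ℓ e) : Set (o ⊔ ℓ ⊔ e) where
  open Category C
  field
    T    : Functor C C
    unit : NaturalTransformation Idᶠ T
    mult : NaturalTransformation (T ∘ᶠ T) T
  open Functor T public
  module η = NaturalTransformation unit
  module μ = NaturalTransformation mult
  field
    μ-assoc     : ∀ {A} → μ.component A ∘ᶜ F₁ (μ.component A)
                          ≈ μ.component A ∘ᶜ μ.component (F₀ A)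
    μ-identityˡ : ∀ {A} → μ.component A ∘ᶜ F₁ (η.component A) ≈ idᶜ
    μ-identityʳ : ∀ {A} → μ.component A ∘ᶜ η.component (F₀ A) ≈ idᶜ

record MonadMap {C : Category o ℓ e} (S T : Monad C) : Set (o ⊔ ℓ ⊔ e) where
  open Category C
  private
    module S = Monad S
    module T = Monad T
  field
    transformation : NaturalTransformation S.T T.T
  open NaturalTransformation transformation public
  field
    preserves-η : ∀ {A} → component A ∘ᶜ S.η.component A ≈ T.η.component A
    preserves-μ : ∀ {A} → component A ∘ᶜ S.μ.component A
                  ≈ T.μ.component A ∘ᶜ (T.F₁ (component A) ∘ᶜ component (S.F₀ A))

infix 4 _≅ᵐ_

record _≅ᵐ_ {C : Category o ℓ e} (S T : Monad C) : Set (o ⊔ ℓ ⊔ e) where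
  open Category C
  field
    to   : MonadMap S T
    from : MonadMap T S
  private
    module to   = MonadMap to
    module from = MonadMap from
  field
    from∘to : ∀ {A} → from.component A ∘ᶜ to.component A ≈ idᶜ
    to∘from : ∀ {A} → to.component A ∘ᶜ from.component A ≈ idᶜ

record FreeMonad {C : Category o ℓ e} (H : Functor C C) : Set (o ⊔ ℓ ⊔ e) where
  open Category C
  field
    monad : Monad C
    γ     : NaturalTransformation H (Monad.T monad)
  private module γ = NaturalTransformation γ

  Extends : (S : Monad C) (ν : NaturalTransformation H (Monad.T S)) →
            MonadMap monad S → Set (o ⊔ e)
  Extends S ν α = ∀ {A} → MonadMap.component α A ∘ᶜ γ.component A
                          ≈ NaturalTransformation.component ν A
  field
    extend  : (S : Monad C) → NaturalTransformation H (Monad.T S) → MonadMap monad S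
    extends : ∀ S ν → Extends S ν (extend S ν)
    unique  : ∀ S ν (α : MonadMap monad S) → Extends S ν α →
              ∀ {A} → MonadMap.component α A ≈ MonadMap.component (extend S ν) A

infix 4 _⊣_

record _⊣_ {C : Category o ℓ e} {D : Category o′ ℓ′ e′}
    (L : Functor C D) (R : Functor D C) : Set (o ⊔ ℓ ⊔ e ⊔ o′ ⊔ ℓ′ ⊔ e′) where
  private
    module C = Category C
    module D = Category D
    module L = Functor L
    module R = Functor R
  field
    unit   : NaturalTransformation Idᶠ (R ∘ᶠ L)
    counit : NaturalTransformation (L ∘ᶠ R) Idᶠ
  module η = NaturalTransformation unit
  module ε = NaturalTransformation counit
  field
    zig : ∀ {A} → ε.component (L.F₀ A) D.∘ᶜ L.F₁ (η.component A) D.≈ D.idᶜ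
    zag : ∀ {B} → R.F₁ (ε.component B) C.∘ᶜ η.component (R.F₀ B) C.≈ C.idᶜ

inducedMonad : {C : Category o ℓ e} {D : Category o′ ℓ′ e′}
  {L : Functor C D} {R : Functor D C} → L ⊣ R → Monad C
inducedMonad {C = C} {D = D} {L = L} {R = R} adj = record
  { T    = R ∘ᶠ L
  ; unit = A.unit
  ; mult = record
    { component = λ X → R.F₁ (A.ε.component (L.F₀ X))
    ; natural   = λ f → C.Equiv.trans (C.Equiv.sym R.homomorphism)
        (C.Equiv.trans (R.F-resp-≈ (A.ε.natural (L.F₁ f))) R.homomorphism)
    }
  ; μ-assoc = C.Equiv.trans (C.Equiv.sym R.homomorphism)
      (C.Equiv.trans (R.F-resp-≈ (A.ε.natural _)) R.homomorphism)
  ; μ-identityˡ = C.Equiv.trans (C.Equiv.sym R.homomorphism)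
      (C.Equiv.trans (R.F-resp-≈ A.zig) R.identity)
  ; μ-identityʳ = A.zag
  }
  where
    module A = _⊣_ adj
    module C = Category C
    module D = Category D
    module L = Functor L
    module R = Functor R

-- Sets are setoids, so that quotients exist; d x y ≃∞ 0∞ iff x ≈ y is
-- the conjunction of the components ≈⇒0 and 0⇒≈ of IsGeneralMetric.

record ExtMetricSpace : Set₁ where
  infix 4 _≈_
  field
    Carrier : Set
    _≈_     : Carrier → Carrier → Set
    d       : Carrier → Carrier → [0,∞]
    isGeneralMetric : IsGeneralMetric _≈_ _≃∞_ _≤∞_ 0∞ _+∞_ d

  private module M = IsGeneralMetric isGeneralMetric
  open M public using (≈-isEquivalence; ≈⇒0; 0⇒≈; triangle)
    renaming (cong to d-cong; sym to d-sym)
  module Eq = IsEquivalence ≈-isEquivalence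

  ≤0⇒≈ : ∀ {x y} → d x y ≤∞ 0∞ → x ≈ y
  ≤0⇒≈ h = 0⇒≈ (h , 0≤∞ {d _ _})

∣_∣ₘ : ExtMetricSpace → Set
∣_∣ₘ = ExtMetricSpace.Carrier

-- The congruence law of IsGeneralMetric follows from the other laws.

private
  module _ {A : Set} {_≈_ : A → A → Set} (d : A → A → [0,∞])
    (isEq : IsEquivalence _≈_)
    (≈⇒≤0 : ∀ {x y} → x ≈ y → d x y ≤∞ 0∞)
    (≤0⇒≈ : ∀ {x y} → d x y ≤∞ 0∞ → x ≈ y)
    (d-sym : ∀ x y → d x y ≤∞ d y x)
    (triangle : ∀ x y z → d x z ≤∞ d x y +∞ d y z)
    where

    private
      0+ : ∀ {a b} → a ≤∞ 0∞ → a +∞ b ≤∞ b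
      0+ {a} {b} a≤0 q ub q′ q<q′ =
        ((0₊ , ≤0⇒Upper {a} a≤0 0₊) , (q , ub)) ,
        ℚₚ.≤-trans (ℚₚ.≤-reflexive (ℚₚ.+-identityˡ (value q))) (ℚₚ.<⇒≤ q<q′)

      +0 : ∀ {a b} → b ≤∞ 0∞ → a +∞ b ≤∞ a
      +0 {a} {b} b≤0 q ua q′ q<q′ =
        ((q , ua) , (0₊ , ≤0⇒Upper {b} b≤0 0₊)) ,
        ℚₚ.≤-trans (ℚₚ.≤-reflexive (ℚₚ.+-identityʳ (value q))) (ℚₚ.<⇒≤ q<q′)

      cong≤ : ∀ {x y u v} → x ≈ y → u ≈ v → d x u ≤∞ d y v
      cong≤ {x} {y} {u} {v} x≈y u≈v =
        ≤∞-trans {d x u} {d x y +∞ d y u} {d y v} (triangle x y u)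
          (≤∞-trans {d x y +∞ d y u} {d y u} {d y v} (0+ {d x y} {d y u} (≈⇒≤0 x≈y))
            (≤∞-trans {d y u} {d y v +∞ d v u} {d y v} (triangle y v u)
              (+0 {d y v} {d v u} (≈⇒≤0 (IsEquivalence.sym isEq u≈v)))))

    mkIsGeneralMetric : IsGeneralMetric _≈_ _≃∞_ _≤∞_ 0∞ _+∞_ d
    mkIsGeneralMetric = record
      { isSemiMetric = record
        { isQuasiSemiMetric = record
          { isPreMetric = record
            { isProtoMetric = record
              { isPartialOrder  = ≤∞-isPartialOrder
              ; ≈-isEquivalence = isEq
              ; cong = λ x≈y u≈v → cong≤ x≈y u≈v ,
                  cong≤ (IsEquivalence.sym isEq x≈y) (IsEquivalence.sym isEq u≈v)
              ; nonNegative = λ {x} {y} → 0≤∞ {d x y}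
              }
            ; ≈⇒0 = λ {x} {y} x≈y → ≈⇒≤0 x≈y , 0≤∞ {d x y}
            }
          ; 0⇒≈ = λ (h , _) → ≤0⇒≈ h
          }
        ; sym = λ x y → d-sym x y , d-sym y x
        }
      ; triangle = triangle
      }

record NonExpansive (X Y : ExtMetricSpace) : Set where
  private
    module X = ExtMetricSpace X
    module Y = ExtMetricSpace Y
  field
    fun           : X.Carrier → Y.Carrier
    non-expansive : ∀ x y → Y.d (fun x) (fun y) ≤∞ X.d x y

  resp-≈ : ∀ {x y} → x X.≈ y → fun x Y.≈ fun y
  resp-≈ {x} {y} x≈y = Y.≤0⇒≈
    (≤∞-trans {Y.d (fun x) (fun y)} {X.d x y} {0∞} (non-expansive x y) (proj₁ (X.≈⇒0 x≈y)))

open NonExpansive public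

Met : Category (lsuc 0ℓ) 0ℓ 0ℓ
Met = record
  { Obj  = ExtMetricSpace
  ; _⇒_  = NonExpansive
  ; _≈_  = λ {X} {Y} f g → ∀ x → ExtMetricSpace._≈_ Y (fun f x) (fun g x)
  ; idᶜ  = λ {X} → record
    { fun           = λ x → x
    ; non-expansive = λ x y → ≤∞-refl {ExtMetricSpace.d X x y}
    }
  ; _∘ᶜ_ = λ {X} {Y} {Z} g f → record
    { fun           = λ x → fun g (fun f x)
    ; non-expansive = λ x y q h →
        non-expansive g (fun f x) (fun f y) q (non-expansive f x y q h)
    }
  ; equiv = λ {X} {Y} → let module Y = ExtMetricSpace Y in record
    { refl  = λ x → Y.Eq.refl
    ; sym   = λ p x → Y.Eq.sym (p x)
    ; trans = λ p q x → Y.Eq.trans (p x) (q x)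
    }
  ; ∘-resp-≈  = λ {X} {Y} {Z} {f} {h} {g} {i} f≈h g≈i x →
      ExtMetricSpace.Eq.trans Z (resp-≈ f (g≈i x)) (f≈h (fun i x))
  ; assoc     = λ {_} {_} {_} {Z} x → ExtMetricSpace.Eq.refl Z
  ; identityˡ = λ {_} {Y} x → ExtMetricSpace.Eq.refl Y
  ; identityʳ = λ {_} {Y} x → ExtMetricSpace.Eq.refl Y
  }

infixr 8 _^ₘ_

_^ₘ_ : ExtMetricSpace → ℕ → ExtMetricSpace
X ^ₘ n = record
  { Carrier = Vector X.Carrier n
  ; _≈_     = _≈ⁿ_
  ; d       = dⁿ
  ; isGeneralMetric = isGeneralMetricⁿ
  }
  where
    module X = ExtMetricSpace X

    _≈ⁿ_ : Vector X.Carrier n → Vector X.Carrier n → Set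
    x ≈ⁿ y = ∀ i → x i X.≈ y i

    dⁿ : Vector X.Carrier n → Vector X.Carrier n → [0,∞]
    dⁿ x y = max λ i → X.d (x i) (y i)

    abstract
      isGeneralMetricⁿ : IsGeneralMetric _≈ⁿ_ _≃∞_ _≤∞_ 0∞ _+∞_ dⁿ
      isGeneralMetricⁿ = mkIsGeneralMetric dⁿ
        (record
          { refl  = λ i → X.Eq.refl
          ; sym   = λ p i → X.Eq.sym (p i)
          ; trans = λ p q i → X.Eq.trans (p i) (q i)
          })
        (λ p q 0≤q i → proj₁ (X.≈⇒0 (p i)) q 0≤q)
        (λ h i → X.≤0⇒≈ λ q 0≤q → h q 0≤q i)
        (λ x y q h i → proj₁ (X.d-sym (x i) (y i)) q (h i))
        (λ x y z q h i → X.triangle (x i) (y i) (z i) q λ q′ q<q′ →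
          let ((r , ur) , (s , us)) , le = h q′ q<q′
          in ((r , ur i) , (s , us i)) , le)

private
  *∞-cancel-0 : ∀ {c a} → 0∞ <∞ c → c *∞ a ≤∞ 0∞ → a ≤∞ 0∞
  *∞-cancel-0 {c} {a} (p₀ , q₀ , _ , p₀<q₀ , q₀≤c) ca≤0 q 0≤q =
    closed a λ q₁ q<q₁ →
      let
        instance
          q₀⁺ : ℚ.Positive (value q₀)
          q₀⁺ = ℚ.positive (ℚₚ.≤-<-trans (0≤value p₀) p₀<q₀)
        0<q₁ : 0₊ <₊ q₁
        0<q₁ = ℚₚ.≤-<-trans 0≤q q<q₁
        0<q₀q₁ : 0₊ <₊ q₀ *₊ q₁
        0<q₀q₁ = subst (ℚ._< value q₀ ℚ.* value q₁) (ℚₚ.*-zeroʳ (value q₀))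
          (ℚₚ.*-monoʳ-<-pos (value q₀) 0<q₁)
        ((r , ur) , (s , us)) , rs≤ =
          ≤0⇒Upper {c *∞ a} ca≤0 0₊ (q₀ *₊ q₁) 0<q₀q₁
        q₀s≤rs : q₀ *₊ s ≤₊ r *₊ s
        q₀s≤rs = *₊-mono {q₀} {r} {s} {s} (q₀≤c r ur) ℚₚ.≤-refl
      in upward a (ℚₚ.*-cancelˡ-≤-pos (value q₀) (ℚₚ.≤-trans q₀s≤rs rs≤)) us

  *∞-zeroʳ : ∀ {c a} → ∃ (Upper c) → a ≤∞ 0∞ → c *∞ a ≤∞ 0∞
  *∞-zeroʳ {c} {a} (r , ur) a≤0 q 0≤q q′ q<q′ =
    ((r , ur) , (0₊ , ≤0⇒Upper {a} a≤0 0₊)) ,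
    ℚₚ.≤-trans (ℚₚ.≤-reflexive (ℚₚ.*-zeroʳ (value r))) (0≤value q′)

  split₊ : ∀ {q q′} → q <₊ q′ →
    ∃[ m ] Σ[ δ ∈ ℚ≥0 ] q <₊ m × 0₊ <₊ δ ×
      (∀ a b x y → a +₊ b ≤₊ m → x ≤₊ a +₊ δ → y ≤₊ b +₊ δ → x +₊ y ≤₊ q′)
  split₊ {q} {q′} q<q′ with dense₊ {q} {q′} q<q′
  ... | m , q<m , m<q′ = m , (δ ,₊ ℚₚ.<⇒≤ 0<δ) , q<m , 0<δ , bound
    where
      m₀ = value m
      δ  = ½ ℚ.* (value q′ ℚ.- m₀)
      0<diff : 0ℚ ℚ.< value q′ ℚ.- m₀
      0<diff = subst (ℚ._< value q′ ℚ.- m₀) (ℚₚ.+-inverseʳ m₀)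
        (ℚₚ.+-monoˡ-< (ℚ.- m₀) m<q′)
      0<δ : 0ℚ ℚ.< δ
      0<δ = subst (ℚ._< δ) (ℚₚ.*-zeroʳ ½) (ℚₚ.*-monoʳ-<-pos ½ 0<diff)
      open ℚₚ.≤-Reasoning
      δ+δ : δ ℚ.+ δ ≡ value q′ ℚ.- m₀
      δ+δ = trans (sym (ℚₚ.*-distribʳ-+ (value q′ ℚ.- m₀) ½ ½))
        (ℚₚ.*-identityˡ (value q′ ℚ.- m₀))
      interchange : ∀ a b → (a ℚ.+ δ) ℚ.+ (b ℚ.+ δ) ≡ (a ℚ.+ b) ℚ.+ (δ ℚ.+ δ)
      interchange a b = trans (ℚₚ.+-assoc a δ (b ℚ.+ δ))
        (trans (cong (a ℚ.+_) (trans (sym (ℚₚ.+-assoc δ b δ))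
          (trans (cong (ℚ._+ δ) (ℚₚ.+-comm δ b)) (ℚₚ.+-assoc b δ δ))))
          (sym (ℚₚ.+-assoc a b (δ ℚ.+ δ))))
      bound : ∀ a b x y → a +₊ b ≤₊ m → value x ℚ.≤ value a ℚ.+ δ →
              value y ℚ.≤ value b ℚ.+ δ → x +₊ y ≤₊ q′
      bound a b x y ab≤m x≤ y≤ = begin
        value x ℚ.+ value y                            ≤⟨ ℚₚ.+-mono-≤ x≤ y≤ ⟩
        (value a ℚ.+ δ) ℚ.+ (value b ℚ.+ δ)            ≡⟨ interchange (value a) (value b) ⟩
        (value a ℚ.+ value b) ℚ.+ (δ ℚ.+ δ)            ≤⟨ ℚₚ.+-monoˡ-≤ (δ ℚ.+ δ) ab≤m ⟩
        m₀ ℚ.+ (δ ℚ.+ δ)                               ≡⟨ cong (m₀ ℚ.+_) δ+δ ⟩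
        m₀ ℚ.+ (value q′ ℚ.- m₀)                       ≡⟨ ℚₚ.+-comm m₀ _ ⟩
        (value q′ ℚ.- m₀) ℚ.+ m₀                       ≡⟨ ℚₚ.+-assoc (value q′) (ℚ.- m₀) m₀ ⟩
        value q′ ℚ.+ (ℚ.- m₀ ℚ.+ m₀)                   ≡⟨ cong (value q′ ℚ.+_) (ℚₚ.+-inverseˡ m₀) ⟩
        value q′ ℚ.+ 0ℚ                                ≡⟨ ℚₚ.+-identityʳ (value q′) ⟩
        value q′                                       ∎

  min₊ : ∀ {c} → ((r , _) (s , _) : ∃ (Upper c)) → ∃[ t ] Upper c t × t ≤₊ r × t ≤₊ s
  min₊ (r , ur) (s , us) with ℚₚ.≤-total (value r) (value s)
  ... | inj₁ r≤s = r , ur , ℚₚ.≤-refl , r≤s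
  ... | inj₂ s≤r = s , us , s≤r , ℚₚ.≤-refl

  *∞-distrib-≤ : ∀ {c a b} → c *∞ (a +∞ b) ≤∞ c *∞ a +∞ c *∞ b
  *∞-distrib-≤ {c} {a} {b} q h q′ q<q′ =
    let
      m , δ , q<m , 0<δ , bound = split₊ {q} {q′} q<q′
      ((u , hu) , (v , hv)) , uv≤m = h m q<m
      <+δ : ∀ w → w <₊ w +₊ δ
      <+δ w = subst (ℚ._< value w ℚ.+ value δ) (ℚₚ.+-identityʳ (value w))
        (ℚₚ.+-monoʳ-< (value w) 0<δ)
      ((r₁ , ur₁) , (s₁ , us₁)) , le₁ = hu (u +₊ δ) (<+δ u)
      ((r₂ , ur₂) , (s₂ , us₂)) , le₂ = hv (v +₊ δ) (<+δ v)
      t , ut , t≤r₁ , t≤r₂ = min₊ {c} (r₁ , ur₁) (r₂ , ur₂)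
    in ((t , ut) , (s₁ +₊ s₂ , λ w lt → ((s₁ , us₁) , (s₂ , us₂)) , ℚₚ.<⇒≤ lt)) ,
       ℚₚ.≤-trans (ℚₚ.≤-reflexive (ℚₚ.*-distribˡ-+ (value t) (value s₁) (value s₂)))
         (bound u v (t *₊ s₁) (t *₊ s₂) uv≤m
           (ℚₚ.≤-trans (*₊-mono {t} {r₁} {s₁} {s₁} t≤r₁ ℚₚ.≤-refl) le₁)
           (ℚₚ.≤-trans (*₊-mono {t} {r₂} {s₂} {s₂} t≤r₂ ℚₚ.≤-refl) le₂))

record Factor : Set₁ where
  field
    factor : [0,∞]
    0<c    : 0∞ <∞ factor
    c<1    : factor <∞ 1∞

open Factor public

infixr 8 _·ₘ_

_·ₘ_ : Factor → ExtMetricSpace → ExtMetricSpace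
c ·ₘ Y = record
  { Carrier = Y.Carrier
  ; _≈_     = Y._≈_
  ; d       = dᶜ
  ; isGeneralMetric = isGeneralMetricᶜ
  }
  where
    module Y = ExtMetricSpace Y

    dᶜ : Y.Carrier → Y.Carrier → [0,∞]
    dᶜ x y = factor c *∞ Y.d x y

    abstract
      isGeneralMetricᶜ : IsGeneralMetric Y._≈_ _≃∞_ _≤∞_ 0∞ _+∞_ dᶜ
      isGeneralMetricᶜ = mkIsGeneralMetric dᶜ
        Y.≈-isEquivalence
        (λ {x} {y} x≈y → *∞-zeroʳ {factor c} {Y.d x y} c<∞ (proj₁ (Y.≈⇒0 x≈y)))
        (λ {x} {y} h → Y.≤0⇒≈ (*∞-cancel-0 {factor c} {Y.d x y} (0<c c) h))
        (λ x y → *∞-monoʳ (factor c) {Y.d x y} {Y.d y x} (proj₁ (Y.d-sym x y)))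
        (λ x y z → ≤∞-trans {dᶜ x z} {factor c *∞ (Y.d x y +∞ Y.d y z)} {dᶜ x y +∞ dᶜ y z}
          (*∞-monoʳ (factor c) {Y.d x z} {Y.d x y +∞ Y.d y z} (Y.triangle x y z))
          (*∞-distrib-≤ {factor c} {Y.d x y} {Y.d y z}))
        where
          c<∞ : ∃ (Upper (factor c))
          c<∞ = let p , _ , c≤p , _ = c<1 c in p , c≤p p ℚₚ.≤-refl

module Coproduct {I : Set} (_≟_ : DecidableEquality I) (Y : I → ExtMetricSpace) where
  private module Y i = ExtMetricSpace (Y i)

  data _≈⨿_ : Σ I Y.Carrier → Σ I Y.Carrier → Set where
    same : ∀ {i x y} → Y._≈_ i x y → (i , x) ≈⨿ (i , y)

  d-at : ∀ {i j} → Dec (i ≡ j) → Y.Carrier i → Y.Carrier j → [0,∞]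
  d-at {i} (yes refl) x y = Y.d i x y
  d-at     (no _)     x y = ∞

  d⨿ : Σ I Y.Carrier → Σ I Y.Carrier → [0,∞]
  d⨿ (i , x) (j , y) = d-at (i ≟ j) x y

  private
    isEq : IsEquivalence _≈⨿_
    isEq = record
      { refl  = same (Y.Eq.refl _)
      ; sym   = λ { (same p) → same (Y.Eq.sym _ p) }
      ; trans = λ { (same p) (same q) → same (Y.Eq.trans _ p q) }
      }

    ≈⇒≤0 : ∀ {x y} → x ≈⨿ y → d⨿ x y ≤∞ 0∞
    ≈⇒≤0 {i , x} {.i , y} (same p) with i ≟ i
    ... | yes refl = proj₁ (Y.≈⇒0 i p)
    ... | no i≢i   = contradiction refl i≢i

    ≤0⇒≈ : ∀ {x y} → d⨿ x y ≤∞ 0∞ → x ≈⨿ y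
    ≤0⇒≈ {i , x} {j , y} h with i ≟ j
    ... | yes refl = same (Y.≤0⇒≈ i h)
    ... | no _     = ∞-absurd 0₊ (≤0⇒Upper {∞} h 0₊)

    d-sym : ∀ x y → d⨿ x y ≤∞ d⨿ y x
    d-sym (i , x) (j , y) q h with i ≟ j | j ≟ i
    ... | yes refl | yes refl = proj₁ (Y.d-sym i x y) q h
    ... | yes refl | no i≢i   = contradiction refl i≢i
    ... | no i≢i   | yes refl = contradiction refl i≢i
    ... | no _     | no _     = h

    triangle : ∀ x y z → d⨿ x z ≤∞ d⨿ x y +∞ d⨿ y z
    triangle (i , x) (j , y) (k , z) q h with i ≟ j | j ≟ k | i ≟ k
    ... | yes refl | yes refl | yes refl = Y.triangle i x y z q h
    ... | yes refl | yes refl | no i≢i   = contradiction refl i≢i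
    ... | no _     | w        | w′       = ∞+-absurd {b = d-at w y z} q h
    ... | yes refl | no _     | w′       = +∞-absurd {a = Y.d i x y} q h

  abstract
    isGeneralMetric⨿ : IsGeneralMetric _≈⨿_ _≃∞_ _≤∞_ 0∞ _+∞_ d⨿
    isGeneralMetric⨿ = mkIsGeneralMetric d⨿ isEq
      (λ {x} {y} → ≈⇒≤0 {x} {y}) (λ {x} {y} → ≤0⇒≈ {x} {y}) d-sym triangle

  ∐ : ExtMetricSpace
  ∐ = record
    { Carrier = Σ I Y.Carrier
    ; _≈_     = _≈⨿_
    ; d       = d⨿
    ; isGeneralMetric = isGeneralMetric⨿
    }

open Coproduct public using (∐; same)

record Signature : Set₁ where
  field
    Op    : Set
    arity : Op → ℕ

open Signature public

-- The countably infinite set of variables is ℕ.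

data Term (S : Signature) : Set where
  var : ℕ → Term S
  app : (f : Op S) → Vector (Term S) (arity S f) → Term S

substitute : ∀ {S} → (ℕ → Term S) → Term S → Term S
substitute σ (var x)    = σ x
substitute σ (app f ts) = app f λ i → substitute σ (ts i)

infix 5 _=[_]_
infix 4 _⊢_

record QuantitativeEquation (S : Signature) : Set where
  constructor _=[_]_
  field
    lhs      : Term S
    distance : ℚ≥0
    rhs      : Term S

substituteEq : ∀ {S} → (ℕ → Term S) → QuantitativeEquation S → QuantitativeEquation S
substituteEq σ (t =[ ε ] s) = substitute σ t =[ ε ] substitute σ s

-- The finite set of premises is presented by a list of its elements.

record ConditionalEquation (S : Signature) : Set where
  constructor _⊢_
  field
    premises   : List (QuantitativeEquation S)
    conclusion : QuantitativeEquation S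

premises-at : ∀ {S n} → ℚ≥0 → Vector ℕ n → Vector ℕ n → List (QuantitativeEquation S)
premises-at ε x y = tabulate λ i → var (x i) =[ ε ] var (y i)

record IsTheory {S : Signature} (U : Pred (ConditionalEquation S) 0ℓ) : Set where
  field
    reflexivity  : ∀ x → U ([] ⊢ var x =[ 0₊ ] var x)
    symmetry     : ∀ x y ε → U ((var x =[ ε ] var y) ∷ [] ⊢ var y =[ ε ] var x)
    triangle     : ∀ x y z ε ε′ →
      U ((var x =[ ε ] var z) ∷ (var z =[ ε′ ] var y) ∷ [] ⊢ var x =[ ε +₊ ε′ ] var y)
    weakening    : ∀ x y ε ε′ → 0₊ <₊ ε′ →
      U ((var x =[ ε ] var y) ∷ [] ⊢ var x =[ ε +₊ ε′ ] var y)
    nonexpansive : ∀ f ε (x y : Vector ℕ (arity S f)) →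
      U (premises-at ε x y ⊢ app f (var ∘ x) =[ ε ] app f (var ∘ y))
    continuity   : ∀ Γ t s ε →
      (∀ ε′ → ε <₊ ε′ → U (Γ ⊢ t =[ ε′ ] s)) → U (Γ ⊢ t =[ ε ] s)
    substitution : ∀ Γ φ σ → U (Γ ⊢ φ) → U (map (substituteEq σ) Γ ⊢ substituteEq σ φ)
    assumption   : ∀ Γ φ → φ ∈ Γ → U (Γ ⊢ φ)
    cut          : ∀ Γ Θ ψ → (∀ φ → φ ∈ Θ → U (Γ ⊢ φ)) → U (Θ ⊢ ψ) → U (Γ ⊢ ψ)

record Theory (S : Signature) : Set₁ where
  field
    Member   : Pred (ConditionalEquation S) 0ℓ
    isTheory : IsTheory Member

open Theory public using (Member)

Axiomatizes : ∀ {S} → Pred (ConditionalEquation S) 0ℓ → Theory S → Set₁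
Axiomatizes A 𝒰 = A ⊆ Member 𝒰 × (∀ 𝒱 → A ⊆ Member 𝒱 → Member 𝒰 ⊆ Member 𝒱)

data Generated {S : Signature} (A : Pred (ConditionalEquation S) 0ℓ)
    : Pred (ConditionalEquation S) 0ℓ where
  axiom        : ∀ {φ} → A φ → Generated A φ
  reflexivity  : ∀ x → Generated A ([] ⊢ var x =[ 0₊ ] var x)
  symmetry     : ∀ x y ε → Generated A ((var x =[ ε ] var y) ∷ [] ⊢ var y =[ ε ] var x)
  triangle     : ∀ x y z ε ε′ → Generated A
    ((var x =[ ε ] var z) ∷ (var z =[ ε′ ] var y) ∷ [] ⊢ var x =[ ε +₊ ε′ ] var y)
  weakening    : ∀ x y ε ε′ → 0₊ <₊ ε′ →
    Generated A ((var x =[ ε ] var y) ∷ [] ⊢ var x =[ ε +₊ ε′ ] var y)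
  nonexpansive : ∀ f ε (x y : Vector ℕ (arity S f)) →
    Generated A (premises-at ε x y ⊢ app f (var ∘ x) =[ ε ] app f (var ∘ y))
  continuity   : ∀ Γ t s ε →
    (∀ ε′ → ε <₊ ε′ → Generated A (Γ ⊢ t =[ ε′ ] s)) → Generated A (Γ ⊢ t =[ ε ] s)
  substitution : ∀ Γ φ σ → Generated A (Γ ⊢ φ) →
    Generated A (map (substituteEq σ) Γ ⊢ substituteEq σ φ)
  assumption   : ∀ Γ φ → φ ∈ Γ → Generated A (Γ ⊢ φ)
  cut          : ∀ Γ Θ ψ → (∀ φ → φ ∈ Θ → Generated A (Γ ⊢ φ)) →
    Generated A (Θ ⊢ ψ) → Generated A (Γ ⊢ ψ)

generated : ∀ {S} → Pred (ConditionalEquation S) 0ℓ → Theory S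
generated A = record
  { Member   = Generated A
  ; isTheory = record
    { reflexivity  = reflexivity
    ; symmetry     = symmetry
    ; triangle     = triangle
    ; weakening    = weakening
    ; nonexpansive = nonexpansive
    ; continuity   = continuity
    ; substitution = substitution
    ; assumption   = assumption
    ; cut          = cut
    }
  }

generated-axiomatizes : ∀ {S} (A : Pred (ConditionalEquation S) 0ℓ) →
                        Axiomatizes A (generated A)
generated-axiomatizes A = axiom , λ 𝒱 A⊆𝒱 → least 𝒱 A⊆𝒱
  where
    least : ∀ 𝒱 → A ⊆ Member 𝒱 → Generated A ⊆ Member 𝒱
    least 𝒱 A⊆𝒱 = go
      where
        module V = IsTheory (Theory.isTheory 𝒱)
        go : Generated A ⊆ Member 𝒱
        go (axiom a)                = A⊆𝒱 a
        go (reflexivity x)          = V.reflexivity x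
        go (symmetry x y ε)         = V.symmetry x y ε
        go (triangle x y z ε ε′)    = V.triangle x y z ε ε′
        go (weakening x y ε ε′ lt)  = V.weakening x y ε ε′ lt
        go (nonexpansive f ε x y)   = V.nonexpansive f ε x y
        go (continuity Γ t s ε h)   = V.continuity Γ t s ε λ ε′ lt → go (h ε′ lt)
        go (substitution Γ φ σ h)   = V.substitution Γ φ σ (go h)
        go (assumption Γ φ φ∈Γ)     = V.assumption Γ φ φ∈Γ
        go (cut Γ Θ ψ h k)          = V.cut Γ Θ ψ (λ φ φ∈Θ → go (h φ φ∈Θ)) (go k)

record QuantitativeAlgebra (S : Signature) : Set₁ where
  field
    space : ExtMetricSpace
    op    : (f : Op S) → NonExpansive (space ^ₘ arity S f) space

  open ExtMetricSpace space public

  eval : (ℕ → Carrier) → Term S → Carrier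
  eval ι (var x)    = ι x
  eval ι (app f ts) = fun (op f) λ i → eval ι (ts i)

  Holds : (ℕ → Carrier) → QuantitativeEquation S → Set
  Holds ι (t =[ ε ] s) = d (eval ι t) (eval ι s) ≤∞ fromℚ ε

  Satisfies : ConditionalEquation S → Set
  Satisfies (Γ ⊢ φ) = ∀ ι → (∀ ψ → ψ ∈ Γ → Holds ι ψ) → Holds ι φ

record Model {S : Signature} (𝒰 : Theory S) : Set₁ where
  field
    algebra   : QuantitativeAlgebra S
    satisfies : ∀ φ → Member 𝒰 φ → QuantitativeAlgebra.Satisfies algebra φ

  open QuantitativeAlgebra algebra public

record Homomorphism {S : Signature} (A B : QuantitativeAlgebra S) : Set where
  private
    module A = QuantitativeAlgebra A
    module B = QuantitativeAlgebra B
  field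
    map-space : NonExpansive A.space B.space
    preserves : ∀ f (xs : Vector A.Carrier (arity S f)) →
      fun map-space (fun (A.op f) xs) B.≈ fun (B.op f) λ i → fun map-space (xs i)

open Homomorphism public

𝕂 : {S : Signature} → Theory S → Category (lsuc 0ℓ) 0ℓ 0ℓ
𝕂 𝒰 = record
  { Obj  = Model 𝒰
  ; _⇒_  = λ A B → Homomorphism (Model.algebra A) (Model.algebra B)
  ; _≈_  = λ g h → map-space g M.≈ map-space h
  ; idᶜ  = λ {A} → record
    { map-space = M.idᶜ
    ; preserves = λ f xs → Model.Eq.refl A
    }
  ; _∘ᶜ_ = λ {A} {B} {C} h g → record
    { map-space = map-space h M.∘ᶜ map-space g
    ; preserves = λ f xs → Model.Eq.trans C
        (resp-≈ (map-space h) (preserves g f xs))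
        (preserves h f λ i → fun (map-space g) (xs i))
    }
  ; equiv = λ {A} {B} → let module B = Model B in record
    { refl  = λ x → B.Eq.refl
    ; sym   = λ p x → B.Eq.sym (p x)
    ; trans = λ p q x → B.Eq.trans (p x) (q x)
    }
  ; ∘-resp-≈  = λ {A} {B} {C} {f} {h} {g} {i} f≈h g≈i x →
      Model.Eq.trans C (resp-≈ (map-space f) (g≈i x)) (f≈h (fun (map-space i) x))
  ; assoc     = λ {_} {_} {_} {D} x → Model.Eq.refl D
  ; identityˡ = λ {_} {B} x → Model.Eq.refl B
  ; identityʳ = λ {_} {B} x → Model.Eq.refl B
  }
  where module M = Category Met

Forgetful : {S : Signature} (𝒰 : Theory S) → Functor (𝕂 𝒰) Met
Forgetful 𝒰 = record
  { F₀ = Model.space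
  ; F₁ = map-space
  ; F-resp-≈     = λ f≈g → f≈g
  ; identity     = λ {A} x → Model.Eq.refl A
  ; homomorphism = λ {_} {_} {C} x → Model.Eq.refl C
  }

record ContractiveSignature : Set₁ where
  field
    signature         : Signature
    at-most-countable : Op signature ↣ ℕ
    contraction       : Op signature → Factor

  -- Decides whether two points of Σ̃ X lie in the same component.
  _≟_ : DecidableEquality (Op signature)
  _≟_ = via-injection at-most-countable ℕₚ._≟_

module _ (S : ContractiveSignature) where
  open ContractiveSignature S

  data Contractivity : Pred (ConditionalEquation signature) 0ℓ where
    contractivity : ∀ f ε δ → factor (contraction f) *∞ fromℚ ε ≤∞ fromℚ δ →
      (x y : Vector ℕ (arity signature f)) →
      Contractivity (premises-at ε x y ⊢ app f (var ∘ x) =[ δ ] app f (var ∘ y))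

  𝒪 : Theory signature
  𝒪 = generated Contractivity

  Σ̃₀ : ExtMetricSpace → ExtMetricSpace
  Σ̃₀ X = ∐ _≟_ λ f → contraction f ·ₘ X ^ₘ arity signature f

  Σ̃ : Functor Met Met
  Σ̃ = record
    { F₀ = Σ̃₀
    ; F₁ = λ {X} {Y} h → record
      { fun           = λ (f , xs) → f , λ i → fun h (xs i)
      ; non-expansive = nonexp {X} {Y} h
      }
    ; F-resp-≈     = λ g≈h (f , xs) → same λ i → g≈h (xs i)
    ; identity     = λ {X} (f , xs) → same λ i → ExtMetricSpace.Eq.refl X
    ; homomorphism = λ {_} {_} {Z} (f , xs) → same λ i → ExtMetricSpace.Eq.refl Z
    }
    where
      abstract
        nonexp : ∀ {X Y} (h : NonExpansive X Y) (x y : ∣ Σ̃₀ X ∣ₘ) →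
          let apply : ∣ Σ̃₀ X ∣ₘ → ∣ Σ̃₀ Y ∣ₘ
              apply = λ (f , xs) → f , λ i → fun h (xs i)
          in ExtMetricSpace.d (Σ̃₀ Y) (apply x) (apply y) ≤∞ ExtMetricSpace.d (Σ̃₀ X) x y
        nonexp {X} {Y} h (f , xs) (g , ys) with f ≟ g
        ... | yes refl =
          *∞-monoʳ (factor (contraction f))
            {ExtMetricSpace.d (Y ^ₘ arity signature f) (λ i → fun h (xs i)) (λ i → fun h (ys i))}
            {ExtMetricSpace.d (X ^ₘ arity signature f) xs ys}
            λ q k i → non-expansive h (xs i) (ys i) q (k i)
        ... | no _ = ≤∞-refl {∞}

{-# OPTIONS --safe #-}

-- Models of 𝒪 S are the same thing as Σ̃-algebras: soundness turns an algebra
-- of Σ̃ into a model, and the axioms with δ = r ε, where r ranges over the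
-- rational upper bounds of the factor, say exactly that an operation is
-- non-expansive on c ·ₘ X ^ₘ n.  Hence every monad N under Σ̃ makes each N X a
-- model, and the homomorphic extensions F X → N X of the units of N form
-- the only monad map from the induced monad to N that commutes with the
-- transformations from Σ̃.  So the induced monad is itself free on Σ̃, and free
-- monads are unique up to isomorphism.

module Submission where

open import Defs

open import Data.Fin.Base using (zero; suc; toℕ; _↑ˡ_; _↑ʳ_)
open import Data.List.Membership.Propositional using (_∈_)
open import Data.List.Membership.Propositional.Properties
  using (∈-map⁺; ∈-tabulate⁺; ∈-tabulate⁻)
open import Data.List.Relation.Unary.Any using (here; there)
open import Data.Nat.Base using (ℕ; zero; suc)
open import Data.Product using (_,_; proj₁; proj₂)
open import Data.Rational.Base as ℚ using ()
import Data.Rational.Properties as ℚₚ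
open import Data.Vec.Functional using (Vector; _++_)
open import Data.Vec.Functional.Properties using (lookup-++ˡ; lookup-++ʳ)
open import Function.Base using (_∘_)
open import Level using (Level)
open import Relation.Binary.Bundles using (Setoid)
open import Relation.Binary.PropositionalEquality
  using (_≡_; refl; trans; subst)
import Relation.Binary.Reasoning.Setoid as SetoidReasoning
open import Relation.Nullary using (yes; no; contradiction)

private
  variable
    o ℓ e o′ ℓ′ e′ : Level

-- Composition of monad maps and uniqueness of free monads.

module _ {C : Category o ℓ e} where
  open Category C

  private
    hom : Obj → Obj → Setoid ℓ e
    hom A B = record { Carrier = A ⇒ B ; _≈_ = _≈_ ; isEquivalence = equiv }

    module ⇒-Reasoning {A B : Obj} = SetoidReasoning (hom A B)

    ≈-refl : ∀ {A B} {f : A ⇒ B} → f ≈ f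
    ≈-refl = Equiv.refl

  idᵐ : (S : Monad C) → MonadMap S S
  idᵐ S = record
    { transformation = record
      { component = λ A → idᶜ
      ; natural   = λ f → Equiv.trans identityˡ (Equiv.sym identityʳ)
      }
    ; preserves-η = identityˡ
    ; preserves-μ = λ {A} → begin
        idᶜ ∘ᶜ S.μ.component A                     ≈⟨ identityˡ ⟩
        S.μ.component A                            ≈⟨ identityʳ ⟨
        S.μ.component A ∘ᶜ idᶜ                     ≈⟨ ∘-resp-≈ ≈-refl S.identity ⟨
        S.μ.component A ∘ᶜ S.F₁ idᶜ                ≈⟨ ∘-resp-≈ ≈-refl identityʳ ⟨
        S.μ.component A ∘ᶜ (S.F₁ idᶜ ∘ᶜ idᶜ)       ∎
    }
    where
      module S = Monad S
      open ⇒-Reasoning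

  infixr 9 _∘ᵐ_

  _∘ᵐ_ : {S T U : Monad C} → MonadMap T U → MonadMap S T → MonadMap S U
  _∘ᵐ_ {S} {T} {U} β α = record
    { transformation = record
      { component = λ A → β.component A ∘ᶜ α.component A
      ; natural   = λ {A} {B} f → begin
          (β.component B ∘ᶜ α.component B) ∘ᶜ S.F₁ f   ≈⟨ assoc ⟩
          β.component B ∘ᶜ (α.component B ∘ᶜ S.F₁ f)   ≈⟨ ∘-resp-≈ ≈-refl (α.natural f) ⟩
          β.component B ∘ᶜ (T.F₁ f ∘ᶜ α.component A)   ≈⟨ assoc ⟨
          (β.component B ∘ᶜ T.F₁ f) ∘ᶜ α.component A   ≈⟨ ∘-resp-≈ (β.natural f) ≈-refl ⟩
          (U.F₁ f ∘ᶜ β.component A) ∘ᶜ α.component A   ≈⟨ assoc ⟩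
          U.F₁ f ∘ᶜ (β.component A ∘ᶜ α.component A)   ∎
      }
    ; preserves-η = Equiv.trans assoc
        (Equiv.trans (∘-resp-≈ ≈-refl α.preserves-η) β.preserves-η)
    ; preserves-μ = λ {A} →
        let
          a   = α.component A
          b   = β.component A
          aS  = α.component (S.F₀ A)
          bS  = β.component (S.F₀ A)
          bT  = β.component (T.F₀ A)
          μ   = U.μ.component A
        in begin
          (b ∘ᶜ a) ∘ᶜ S.μ.component A                 ≈⟨ assoc ⟩
          b ∘ᶜ (a ∘ᶜ S.μ.component A)                 ≈⟨ ∘-resp-≈ ≈-refl α.preserves-μ ⟩
          b ∘ᶜ (T.μ.component A ∘ᶜ (T.F₁ a ∘ᶜ aS))    ≈⟨ assoc ⟨
          (b ∘ᶜ T.μ.component A) ∘ᶜ (T.F₁ a ∘ᶜ aS)    ≈⟨ ∘-resp-≈ β.preserves-μ ≈-refl ⟩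
          (μ ∘ᶜ (U.F₁ b ∘ᶜ bT)) ∘ᶜ (T.F₁ a ∘ᶜ aS)     ≈⟨ assoc ⟩
          μ ∘ᶜ ((U.F₁ b ∘ᶜ bT) ∘ᶜ (T.F₁ a ∘ᶜ aS))     ≈⟨ ∘-resp-≈ ≈-refl (begin
            (U.F₁ b ∘ᶜ bT) ∘ᶜ (T.F₁ a ∘ᶜ aS)            ≈⟨ assoc ⟩
            U.F₁ b ∘ᶜ (bT ∘ᶜ (T.F₁ a ∘ᶜ aS))            ≈⟨ ∘-resp-≈ ≈-refl assoc ⟨
            -- Naturality of `β` at the component `a` is the only step here that is not
            -- reassociation or functoriality.
            U.F₁ b ∘ᶜ ((bT ∘ᶜ T.F₁ a) ∘ᶜ aS)            ≈⟨ ∘-resp-≈ ≈-refl (∘-resp-≈ (β.natural a) ≈-refl) ⟩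
            U.F₁ b ∘ᶜ ((U.F₁ a ∘ᶜ bS) ∘ᶜ aS)            ≈⟨ ∘-resp-≈ ≈-refl assoc ⟩
            U.F₁ b ∘ᶜ (U.F₁ a ∘ᶜ (bS ∘ᶜ aS))            ≈⟨ assoc ⟨
            (U.F₁ b ∘ᶜ U.F₁ a) ∘ᶜ (bS ∘ᶜ aS)            ≈⟨ ∘-resp-≈ U.homomorphism ≈-refl ⟨
            U.F₁ (b ∘ᶜ a) ∘ᶜ (bS ∘ᶜ aS)                 ∎) ⟩
          μ ∘ᶜ (U.F₁ (b ∘ᶜ a) ∘ᶜ (bS ∘ᶜ aS))          ∎
    }
    where
      module S = Monad S
      module T = Monad T
      module U = Monad U
      module α = MonadMap α
      module β = MonadMap β
      open ⇒-Reasoning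

  freeMonad-unique : {H : Functor C C} (P Q : FreeMonad H) →
                     FreeMonad.monad P ≅ᵐ FreeMonad.monad Q
  freeMonad-unique {H} P Q = record
    { to      = to P Q
    ; from    = to Q P
    ; from∘to = round-trip P Q
    ; to∘from = round-trip Q P
    }
    where
      open FreeMonad

      to : (P Q : FreeMonad H) → MonadMap (monad P) (monad Q)
      to P Q = extend P (monad Q) (γ Q)

      -- The round trip and the identity are both monad maps that extend `γ P`, so each equals
      -- `extend P (monad P) (γ P)`.
      round-trip : ∀ P Q {A} →
        MonadMap.component (to Q P) A ∘ᶜ MonadMap.component (to P Q) A ≈ idᶜ
      round-trip P Q = Equiv.trans
        (unique P (monad P) (γ P) (to Q P ∘ᵐ to P Q)
          (Equiv.trans assoc (Equiv.trans
            (∘-resp-≈ ≈-refl (extends P (monad Q) (γ Q)))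
            (extends Q (monad P) (γ P)))))
        (Equiv.sym (unique P (monad P) (γ P) (idᵐ (monad P)) identityˡ))

-- Scaling of distances and assignments of variables.

private
  variable
    A : Set

*∞-mono-≤ : ∀ c {a b} → a ≤∞ b → c *∞ a ≤∞ c *∞ b
*∞-mono-≤ c a≤b q h q′ q<q′ with h q′ q<q′
... | (r , (s , us)) , rs≤q′ = (r , (s , a≤b s us)) , rs≤q′

-- Supplies the side condition of the contractivity axiom when ε is `s` and δ is `r *₊ s`.
*∞-fromℚ-≤ : ∀ c {r} → Upper c r → ∀ s → c *∞ fromℚ s ≤∞ fromℚ (r *₊ s)
*∞-fromℚ-≤ c {r} ur s q rs≤q q′ q<q′ =
  ((r , ur) , (s , ℚₚ.≤-refl)) , ℚₚ.≤-trans rs≤q (ℚₚ.<⇒≤ q<q′)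

-- The factor has a rational upper bound `p` below 1, and `p *₊ q ≤₊ q`. Hence contractive
-- operations are non-expansive, as quantitative algebras require.
factor-*∞-≤ : ∀ (c : Factor) a → factor c *∞ a ≤∞ a
factor-*∞-≤ c a q ua q′ q<q′ with c<1 c
... | p , p′ , c≤p , p<p′ , p′≤1 =
  ((p , c≤p p ℚₚ.≤-refl) , (q , ua)) , ℚₚ.≤-trans pq≤q (ℚₚ.<⇒≤ q<q′)
  where
    p≤1 : p ≤₊ 1₊
    p≤1 = ℚₚ.≤-trans (ℚₚ.<⇒≤ p<p′) (p′≤1 1₊ ℚₚ.≤-refl)
    pq≤q : p *₊ q ≤₊ q
    pq≤q = subst (value p ℚ.* value q ℚ.≤_) (ℚₚ.*-identityˡ (value q))
      (ℚₚ.*-monoʳ-≤-nonNeg (value q) ⦃ ℚ.nonNegative (0≤value q) ⦄ p≤1)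

-- An assignment must value every variable, so those past the end of the vector receive the default.
assign : ∀ {n} → A → Vector A n → ℕ → A
assign {n = zero}  a xs _       = a
assign {n = suc _} a xs zero    = xs zero
assign {n = suc _} a xs (suc m) = assign a (xs ∘ suc) m

assign-toℕ : ∀ {n} (a : A) (xs : Vector A n) i → assign a xs (toℕ i) ≡ xs i
assign-toℕ a xs zero    = refl
assign-toℕ a xs (suc i) = assign-toℕ a (xs ∘ suc) i

-- Satisfaction in quantitative algebras and soundness of deduction.

module AlgebraProperties {S : Signature} (A : QuantitativeAlgebra S) where
  open QuantitativeAlgebra A renaming (triangle to d-triangle)

  ≡⇒≈ : ∀ {x y} → x ≡ y → x ≈ y
  ≡⇒≈ refl = Eq.refl

  d-resp-≤ : ∀ {x y u v a} → x ≈ y → u ≈ v → d y v ≤∞ a → d x u ≤∞ a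
  d-resp-≤ x≈y u≈v h q uq = proj₁ (d-cong x≈y u≈v) q (h q uq)

  eval-substitute : ∀ ι σ t → eval ι (substitute σ t) ≈ eval (eval ι ∘ σ) t
  eval-substitute ι σ (var x)    = Eq.refl
  eval-substitute ι σ (app f ts) = resp-≈ (op f) λ i → eval-substitute ι σ (ts i)

  Holds-substitute⁺ : ∀ ι σ φ → Holds (eval ι ∘ σ) φ → Holds ι (substituteEq σ φ)
  Holds-substitute⁺ ι σ (t =[ ε ] s) =
    d-resp-≤ {a = fromℚ ε} (eval-substitute ι σ t) (eval-substitute ι σ s)

  Holds-substitute⁻ : ∀ ι σ φ → Holds ι (substituteEq σ φ) → Holds (eval ι ∘ σ) φ
  Holds-substitute⁻ ι σ (t =[ ε ] s) = d-resp-≤ {a = fromℚ ε}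
    (Eq.sym (eval-substitute ι σ t)) (Eq.sym (eval-substitute ι σ s))

  premises-at⁺ : ∀ {n} ι ε (x y : Vector ℕ n) → (∀ i → d (ι (x i)) (ι (y i)) ≤∞ fromℚ ε) →
                 ∀ ψ → ψ ∈ premises-at ε x y → Holds ι ψ
  premises-at⁺ ι ε x y h ψ ψ∈ with ∈-tabulate⁻ ψ∈
  ... | i , refl = h i

  premises-at⁻ : ∀ {n} ι ε (x y : Vector ℕ n) →
                 (∀ ψ → ψ ∈ premises-at ε x y → Holds ι ψ) →
                 ∀ i → d (ι (x i)) (ι (y i)) ≤∞ fromℚ ε
  premises-at⁻ ι ε x y h i = h _ (∈-tabulate⁺ i)

  -- Passes from equations between variables to arbitrary elements. The two tuples are named by
  -- disjoint blocks of `n` variables, so one assignment realizes both even when they share entries.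
  op-bound : ∀ f ε δ →
    (∀ x y → Satisfies (premises-at ε x y ⊢ app f (var ∘ x) =[ δ ] app f (var ∘ y))) →
    ∀ xs ys → (∀ i → d (xs i) (ys i) ≤∞ fromℚ ε) →
    d (fun (op f) xs) (fun (op f) ys) ≤∞ fromℚ δ
  op-bound f ε δ sat xs ys h =
    d-resp-≤ {a = fromℚ δ} (resp-≈ (op f) (Eq.sym ∘ ι-x)) (resp-≈ (op f) (Eq.sym ∘ ι-y))
      (sat x y ι (premises-at⁺ ι ε x y λ i → d-resp-≤ {a = fromℚ ε} (ι-x i) (ι-y i) (h i)))
    where
      n = arity S f

      x y : Vector ℕ n
      x i = toℕ (i ↑ˡ n)
      y i = toℕ (n ↑ʳ i)

      -- A default value is needed; xs may have length 0, but then op f xs is a point.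
      ι : ℕ → Carrier
      ι = assign (fun (op f) xs) (xs ++ ys)

      ι-x : ∀ i → ι (x i) ≈ xs i
      ι-x i = ≡⇒≈ (trans (assign-toℕ _ (xs ++ ys) (i ↑ˡ n)) (lookup-++ˡ xs ys i))

      ι-y : ∀ i → ι (y i) ≈ ys i
      ι-y i = ≡⇒≈ (trans (assign-toℕ _ (xs ++ ys) (n ↑ʳ i)) (lookup-++ʳ xs ys i))

  -- Induction on derivations: the metric laws and non-expansiveness of the operations validate the
  -- built-in rules, leaving only the axioms to be checked.
  sound : ∀ {Ax : ConditionalEquation S → Set} → (∀ {φ} → Ax φ → Satisfies φ) →
          ∀ {φ} → Generated Ax φ → Satisfies φ
  sound {Ax} ax = go
    where
      go : ∀ {φ} → Generated Ax φ → Satisfies φ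
      go (axiom a) = ax a
      go (reflexivity x) ι _ = proj₁ (≈⇒0 Eq.refl)
      go (symmetry x y ε) ι h q ε≤q =
        proj₁ (d-sym (ι y) (ι x)) q (h _ (here refl) q ε≤q)
      go (triangle x y z ε ε′) ι h q ε+ε′≤q =
        d-triangle (ι x) (ι z) (ι y) q λ q′ q<q′ →
          ((ε , h _ (here refl) ε ℚₚ.≤-refl) , (ε′ , h _ (there (here refl)) ε′ ℚₚ.≤-refl)) ,
          ℚₚ.≤-trans ε+ε′≤q (ℚₚ.<⇒≤ q<q′)
      go (weakening x y ε ε′ _) ι h q ε+ε′≤q =
        h _ (here refl) q (ℚₚ.≤-trans ε≤ε+ε′ ε+ε′≤q)
        where
          ε≤ε+ε′ : ε ≤₊ ε +₊ ε′
          ε≤ε+ε′ = subst (ℚ._≤ value (ε +₊ ε′)) (ℚₚ.+-identityʳ (value ε))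
            (ℚₚ.+-monoʳ-≤ (value ε) (0≤value ε′))
      go (nonexpansive f ε x y) ι h q ε≤q =
        non-expansive (op f) (ι ∘ x) (ι ∘ y) q λ i → premises-at⁻ ι ε x y h i q ε≤q
      go (continuity Γ t s ε g) ι h q ε≤q =
        -- Closure of the set of upper bounds under infima is exactly the continuity rule.
        closed (d (eval ι t) (eval ι s)) λ q′ q<q′ →
          go (g q′ (ℚₚ.≤-<-trans ε≤q q<q′)) ι h q′ ℚₚ.≤-refl
      go (substitution Γ φ σ g) ι h = Holds-substitute⁺ ι σ φ
        (go g (eval ι ∘ σ) λ ψ ψ∈Γ →
          Holds-substitute⁻ ι σ ψ (h _ (∈-map⁺ (substituteEq σ) ψ∈Γ)))
      go (assumption Γ φ φ∈Γ) ι h = h φ φ∈Γ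
      go (cut Γ Θ ψ g k) ι h = go k ι λ φ φ∈Θ → go (g φ φ∈Θ) ι h

-- Passage between algebras of the endofunctor and models of the theory.

module Algebras (S : ContractiveSignature) where
  open ContractiveSignature S

  algebra⇒model : (X : ExtMetricSpace) → NonExpansive (Σ̃₀ S X) X → Model (𝒪 S)
  algebra⇒model X a = record
    { algebra   = algebra
    ; satisfies = λ φ → sound contractivity-sound
    }
    where
      open ExtMetricSpace X

      component-contracts : ∀ f xs ys →
        d (fun a (f , xs)) (fun a (f , ys))
          ≤∞ factor (contraction f) *∞ max λ i → d (xs i) (ys i)
      component-contracts f xs ys q h = non-expansive a (f , xs) (f , ys) q within
        where
          within : Upper (ExtMetricSpace.d (Σ̃₀ S X) (f , xs) (f , ys)) q
          -- The coproduct distance reduces to the scaled one only after this decision is evaluated.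
          within with f ≟ f
          ... | yes refl = h
          ... | no f≢f   = contradiction refl f≢f

      algebra : QuantitativeAlgebra signature
      algebra = record
        { space = X
        ; op    = λ f → record
          { fun           = λ xs → fun a (f , xs)
          ; non-expansive = λ xs ys q h → component-contracts f xs ys q
              (factor-*∞-≤ (contraction f) (max λ i → d (xs i) (ys i)) q h)
          }
        }

      open AlgebraProperties algebra using (sound; premises-at⁻)

      contractivity-sound : ∀ {φ} → Contractivity S φ →
                            QuantitativeAlgebra.Satisfies algebra φ
      contractivity-sound (contractivity f ε δ cε≤δ x y) ι h q δ≤q =
        component-contracts f (ι ∘ x) (ι ∘ y) q
          (*∞-mono-≤ (factor (contraction f)) {max λ i → d (ι (x i)) (ι (y i))} {fromℚ ε}
            (λ r ε≤r i → premises-at⁻ ι ε x y h i r ε≤r) q (cε≤δ q δ≤q))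

  model⇒algebra : (M : Model (𝒪 S)) → NonExpansive (Σ̃₀ S (Model.space M)) (Model.space M)
  model⇒algebra M = record
    { fun           = λ (f , xs) → fun (op f) xs
    ; non-expansive = contracts
    }
    where
      open Model M
      open AlgebraProperties algebra using (op-bound)

      contracts : ∀ u v → d (fun (op (proj₁ u)) (proj₂ u)) (fun (op (proj₁ v)) (proj₂ v))
                          ≤∞ ExtMetricSpace.d (Σ̃₀ S space) u v
      contracts (f , xs) (g , ys) q h with f ≟ g
      -- Distinct components lie at distance ∞, an infimum over the empty type; any rational
      -- strictly above `q` extracts an impossible index.
      ... | no _ with h (q +₊ 1₊) q<q+1
        where
          q<q+1 : q <₊ q +₊ 1₊
          q<q+1 = subst (ℚ._< value q ℚ.+ value 1₊) (ℚₚ.+-identityʳ (value q))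
            (ℚₚ.+-monoʳ-< (value q) (ℚₚ.positive⁻¹ (value 1₊)))
      ... | () , _
      contracts (f , xs) (g , ys) q h | yes refl =
        -- The scaled distance is an infimum of products `r *₊ s`, which need not be attained at
        -- `q`. Every larger `q′` dominates some product, and that product is the δ of an axiom.
        closed (d (fun (op f) xs) (fun (op f) ys)) λ q′ q<q′ →
          let ((r , ur) , (s , us)) , rs≤q′ = h q′ q<q′
          in op-bound f s (r *₊ s)
               (λ x y → satisfies _ (axiom (contractivity f s (r *₊ s)
                 (*∞-fromℚ-≤ (factor (contraction f)) ur s) x y)))
               xs ys (λ i p s≤p → upward (d (xs i) (ys i)) {s} {p} s≤p (us i))
               q′ rs≤q′

-- Uniqueness of transposes under an adjunction.

module _ {C : Category o ℓ e} {D : Category o′ ℓ′ e′}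
    {L : Functor C D} {R : Functor D C} (L⊣R : L ⊣ R) where
  private
    module C = Category C
    module D = Category D
    module L = Functor L
    module R = Functor R
  open _⊣_ L⊣R

  -- Either morphism is recovered from its transpose by applying `L` and composing with the counit.
  adjoint-unique : ∀ X M (g h : L.F₀ X D.⇒ M) →
    R.F₁ g C.∘ᶜ η.component X C.≈ R.F₁ h C.∘ᶜ η.component X → g D.≈ h
  adjoint-unique X M g h gη≈hη =
    D.Equiv.trans (D.Equiv.sym (recover g)) (D.Equiv.trans
      (D.∘-resp-≈ D.Equiv.refl (L.F-resp-≈ gη≈hη)) (recover h))
    where
      recover : (k : L.F₀ X D.⇒ M) →
        ε.component M D.∘ᶜ L.F₁ (R.F₁ k C.∘ᶜ η.component X) D.≈ k
      recover k =
        D.Equiv.trans (D.∘-resp-≈ D.Equiv.refl L.homomorphism)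
        (D.Equiv.trans (D.Equiv.sym D.assoc)
        (D.Equiv.trans (D.∘-resp-≈ (ε.natural k) D.Equiv.refl)
        (D.Equiv.trans D.assoc
        (D.Equiv.trans (D.∘-resp-≈ D.Equiv.refl zig) D.identityʳ))))

-- Freeness of the monad induced by the free models.

module _ (S : ContractiveSignature)
    (F : Functor Met (𝕂 (𝒪 S))) (F⊣U : F ⊣ Forgetful (𝒪 S)) where
  open Algebras S

  private
    module Met = Category Met
    module 𝕂 = Category (𝕂 (𝒪 S))
    module F = Functor F
    module A = _⊣_ F⊣U
    T = inducedMonad F⊣U
    module T = Monad T

  -- Sends `(f , xs)` to the operation `f` of the free model applied to the generators `xs`.
  Σ̃⇒T : NaturalTransformation (Σ̃ S) T.T
  Σ̃⇒T = record
    { component = λ X → model⇒algebra (F.F₀ X) Met.∘ᶜ Functor.F₁ (Σ̃ S) (T.η.component X)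
    ; natural   = λ {X} {Y} h (f , xs) → let module FY = Model (F.F₀ Y) in
        FY.Eq.sym (FY.Eq.trans
          (preserves (F.F₁ h) f _)
          (resp-≈ (FY.op f) λ i → FY.Eq.sym (A.η.natural h (xs i))))
    }

  module Extension (N : Monad Met) (ν : NaturalTransformation (Σ̃ S) (Monad.T N)) where
    private
      module N = Monad N
      module ν = NaturalTransformation ν
      module ≈N X = ExtMetricSpace.Eq (N.F₀ X)

    model : ExtMetricSpace → Model (𝒪 S)
    model X = algebra⇒model (N.F₀ X) (N.μ.component X Met.∘ᶜ ν.component (N.F₀ X))

    -- With `μ-hom`, this makes both sides of each monad map law homomorphisms, so that
    -- `adjoint-unique` applies.
    F₁-hom : ∀ {X Y} → NonExpansive X Y → model X 𝕂.⇒ model Y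
    F₁-hom {X} {Y} h = record
      { map-space = N.F₁ h
      ; preserves = λ f xs → ≈N.trans Y
          (≈N.sym Y (N.μ.natural h (fun (ν.component (N.F₀ X)) (f , xs))))
          (resp-≈ (N.μ.component Y) (≈N.sym (N.F₀ Y) (ν.natural (N.F₁ h) (f , xs))))
      }

    μ-hom : ∀ X → model (N.F₀ X) 𝕂.⇒ model X
    μ-hom X = record
      { map-space = N.μ.component X
      ; preserves = λ f xs → ≈N.trans X
          (≈N.sym X (N.μ-assoc (fun (ν.component (N.F₀ (N.F₀ X))) (f , xs))))
          (resp-≈ (N.μ.component X) (≈N.sym (N.F₀ X) (ν.natural (N.μ.component X) (f , xs))))
      }

    extension : ∀ X → F.F₀ X 𝕂.⇒ model X
    extension X = 𝕂._∘ᶜ_ {F.F₀ X} {F.F₀ (N.F₀ X)} {model X}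
      (A.ε.component (model X)) (F.F₁ (N.η.component X))

    extension-η : ∀ X → map-space (extension X) Met.∘ᶜ T.η.component X Met.≈ N.η.component X
    extension-η X x = ≈N.trans X
      (resp-≈ (map-space (A.ε.component (model X)))
        (Model.Eq.sym (F.F₀ (N.F₀ X)) (A.η.natural (N.η.component X) x)))
      (A.zag {model X} (fun (N.η.component X) x))

    extension-map : MonadMap T N
    extension-map = record
      { transformation = record
        { component = λ X → map-space (extension X)
        ; natural   = λ {X} {Y} h →
            adjoint-unique F⊣U X (model Y)
              (𝕂._∘ᶜ_ {F.F₀ X} {F.F₀ Y} {model Y} (extension Y) (F.F₁ h))
              (𝕂._∘ᶜ_ {F.F₀ X} {model X} {model Y} (F₁-hom h) (extension X))
              λ x → ≈N.trans Y
                (resp-≈ (map-space (extension Y)) (Model.Eq.sym (F.F₀ Y) (A.η.natural h x)))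
                (≈N.trans Y (extension-η Y (fun h x))
                (≈N.trans Y (N.η.natural h x)
                  (resp-≈ (N.F₁ h) (≈N.sym X (extension-η X x)))))
        }
      ; preserves-η = λ {X} → extension-η X
      ; preserves-μ = λ {X} →
          -- Along the unit both sides become `extension X`: the left by a triangle identity, the
          -- right by naturality of the unit of `N` and its unit law.
          adjoint-unique F⊣U (T.F₀ X) (model X)
            (𝕂._∘ᶜ_ {F.F₀ (T.F₀ X)} {F.F₀ X} {model X} (extension X) (A.ε.component (F.F₀ X)))
            (𝕂._∘ᶜ_ {F.F₀ (T.F₀ X)} {model (N.F₀ X)} {model X} (μ-hom X)
              (𝕂._∘ᶜ_ {F.F₀ (T.F₀ X)} {model (T.F₀ X)} {model (N.F₀ X)}
                (F₁-hom (map-space (extension X))) (extension (T.F₀ X))))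
            λ t → ≈N.trans X
              (resp-≈ (map-space (extension X)) (A.zag {F.F₀ X} t))
              (≈N.sym X (≈N.trans X
                (resp-≈ (N.μ.component X) (≈N.trans (N.F₀ X)
                  (resp-≈ (N.F₁ (map-space (extension X))) (extension-η (T.F₀ X) t))
                  (≈N.sym (N.F₀ X) (N.η.natural (map-space (extension X)) t))))
                (N.μ-identityʳ (fun (map-space (extension X)) t))))
      }

    -- A homomorphism commutes with `f`, and generators go to the unit of `N`. Naturality of `ν`
    -- moves that unit outside, where `μ` cancels it.
    extension-extends : ∀ X →
      map-space (extension X) Met.∘ᶜ NaturalTransformation.component Σ̃⇒T X Met.≈ ν.component X
    extension-extends X (f , xs) = ≈N.trans X
      (preserves (extension X) f _)
      (≈N.trans X
        (resp-≈ (N.μ.component X Met.∘ᶜ ν.component (N.F₀ X))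
          (same λ i → extension-η X (xs i)))
        (≈N.trans X
          (resp-≈ (N.μ.component X) (ν.natural (N.η.component X) (f , xs)))
          (N.μ-identityˡ (fun (ν.component X) (f , xs)))))

    -- An operation of F X is μ after Σ̃⇒T, both of which α preserves.
    monadMap-hom : (α : MonadMap T N) →
      (∀ {X} → MonadMap.component α X Met.∘ᶜ NaturalTransformation.component Σ̃⇒T X
               Met.≈ ν.component X) →
      ∀ X → F.F₀ X 𝕂.⇒ model X
    monadMap-hom α αγ≈ν X = record
      { map-space = α.component X
      ; preserves = λ f xs → ≈N.trans X
          (resp-≈ (α.component X) (FX.Eq.sym (op≈μγ f xs)))
          (≈N.trans X
            (α.preserves-μ (fun (γ.component (T.F₀ X)) (f , xs)))
            (resp-≈ (N.μ.component X) (≈N.trans (N.F₀ X)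
              (resp-≈ (N.F₁ (α.component X)) (αγ≈ν (f , xs)))
              (≈N.sym (N.F₀ X) (ν.natural (α.component X) (f , xs))))))
      }
      where
        module α = MonadMap α
        module γ = NaturalTransformation Σ̃⇒T
        module FX = Model (F.F₀ X)

        op≈μγ : ∀ f xs →
          fun (T.μ.component X) (fun (γ.component (T.F₀ X)) (f , xs)) FX.≈ fun (FX.op f) xs
        op≈μγ f xs = FX.Eq.trans
          (preserves (A.ε.component (F.F₀ X)) f _)
          (resp-≈ (FX.op f) λ i → A.zag {F.F₀ X} (xs i))

  inducedMonad-free : FreeMonad (Σ̃ S)
  inducedMonad-free = record
    { monad   = T
    ; γ       = Σ̃⇒T
    ; extend  = Extension.extension-map
    ; extends = λ N ν {X} → Extension.extension-extends N ν X
    -- Both homomorphisms restrict to the unit of `N` on generators.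
    ; unique  = λ N ν α αγ≈ν {X} → let open Extension N ν in
        adjoint-unique F⊣U X (model X) (monadMap-hom α (λ {Y} → αγ≈ν {Y}) X) (extension X)
          λ x → ExtMetricSpace.Eq.trans (Monad.F₀ N X)
            (MonadMap.preserves-η α x)
            (ExtMetricSpace.Eq.sym (Monad.F₀ N X) (extension-η X x))
    }

theorem4p4 : (S : ContractiveSignature)
    (F : Functor Met (𝕂 (𝒪 S))) (F⊣U : F ⊣ Forgetful (𝒪 S))
    (Σ̃* : FreeMonad (Σ̃ S)) →
    inducedMonad F⊣U ≅ᵐ FreeMonad.monad Σ̃*
theorem4p4 S F F⊣U Σ̃* = freeMonad-unique (inducedMonad-free S F F⊣U) Σ̃*
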